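{- Let $S$ be a commutative semiring. The class of $S$-weighted languages recognized by WAFA over $S$ is closed under inverses of homomorphisms: for all alphabets $\Lambda,\Sigma$, every homomorphism $h:\Lambda^*\to\Sigma^*$ and every weighted language $s:\Sigma^*\to S$ recognized by a WAFA, the weighted language $h^{ -1}(s):\Lambda^*\to S$, $h^{ -1}(s)(w)=s(h(w))$, is recognized by a WAFA.
   Context: An alphabet is a finite non-empty set; $\Sigma^*$ is the free monoid of finite words over $\Sigma$, $\varepsilon$ the empty word. A homomorphism $h:\Lambda^*\to\Sigma^*$ satisfies $h(uv)=h(u)h(v)$ (monoid homomorphism; letters may be mapped to $\varepsilon$). A semiring $(S,+,\cdot,0,1)$ has $(S,+,0)$ a commutative monoid, $(S,\cdot,1)$ a monoid, $0$ absorbing, and both distributive laws; it is commutative if $\cdot$ is commutative. For $Q=\{q_1,\dots,q_n\}$, $S[Q]$ is the semiring of polynomials with coefficients in $S$ in commuting indeterminates $q_1,\dots,q_n$, and $p\langle s_1,\dots,s_n\rangle$ denotes simultaneous substitution. A weighted alternating finite automaton (WAFA) over $S$ and $\Sigma$ is $\mathcal A=(Q,\Sigma,\delta,P_0,\tau)$ with $Q=\{q_1,\dots,q_n\}$ a finite set of states, $\delta:Q\times\Sigma\to S[Q]$, $P_0\in S[Q]$, $\tau:Q\to S$. State behavior: $[\mathcal A]_q(\varepsilon)=\tau(q)$, $[\mathcal A]_q(av)=\delta(q,a)\langle[\mathcal A]_{q_1}(v),\dots,[\mathcal A]_{q_n}(v)\rangle$ for $a\in\Sigma$. Behavior: $[\![\mathcal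 A]\!](w)=P_0\langle[\mathcal A]_{q_1}(w),\dots,[\mathcal A]_{q_n}(w)\rangle$. $\mathcal A$ recognizes $s:\Sigma^*\to S$ if $[\![\mathcal A]\!]=s$. -}

module Defs where

open import Level using (Level; _⊔_; suc)
open import Algebra.Bundles using (CommutativeSemiring)
open import Algebra.Definitions.RawSemiring as RawSemiringDefinitions using ()
open import Algebra.Morphism.Structures using (module MonoidMorphisms)
open import Data.Fin.Base using (Fin)
open import Data.List.Base using (List; []; _∷_; foldr; ++-[]-rawMonoid)
open import Data.Nat.Base as ℕ using (ℕ)
open import Data.Product.Base using (_×_; _,_; Σ-syntax)
open import Data.Vec.Base using (Vec; lookup)
open import Function.Bundles using (_↔_)

record Alphabet (a : Level) : Set (suc a) where
  field
    Letter      : Set a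
    size-1      : ℕ
    enumeration : Letter ↔ Fin (ℕ.suc size-1)

open Alphabet public using (Letter)

Word : ∀ {a} → Alphabet a → Set a
Word A = List (Letter A)

-- The free monoid on A is `++-[]-rawMonoid (Letter A)`, with propositional
-- equality of words.
IsWordHomomorphism : ∀ {a b} (A : Alphabet a) (B : Alphabet b) →
                     (Word A → Word B) → Set (a ⊔ b)
IsWordHomomorphism A B = IsMonoidHomomorphism
  where open MonoidMorphisms (++-[]-rawMonoid (Letter A)) (++-[]-rawMonoid (Letter B))

module _ {c ℓ} (S : CommutativeSemiring c ℓ) where

  open CommutativeSemiring S using (Carrier; _≈_; _+_; _*_; 0#; rawSemiring)
  open RawSemiringDefinitions rawSemiring using (product; _^_)

  WeightedLanguage : ∀ {a} → Alphabet a → Set (c ⊔ a)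
  WeightedLanguage A = Word A → Carrier

  -- A polynomial in the commuting indeterminates q₀, …, qₙ₋₁ is given as a
  -- finite formal sum of terms: (s , e) stands for s · ∏ᵢ qᵢ ^ eᵢ.  Distinct
  -- lists may represent the same polynomial (the coefficient of a monomial is
  -- the sum of all its entries), but substitution does not distinguish them.
  Polynomial : ℕ → Set c
  Polynomial n = List (Carrier × Vec ℕ n)

  infix 8 _⟨_⟩

  _⟨_⟩ : ∀ {n} → Polynomial n → (Fin n → Carrier) → Carrier
  p ⟨ x ⟩ = foldr (λ (s , e) t → s * product (λ i → x i ^ lookup e i) + t) 0# p

  -- The set of states is {q₀, …, qₙ₋₁}, identified with Fin n.
  record WAFA {a} (A : Alphabet a) : Set (c ⊔ a) where
    field
      n  : ℕ
      δ  : Fin n → Letter A → Polynomial n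
      P₀ : Polynomial n
      τ  : Fin n → Carrier

    stateBehavior : Fin n → Word A → Carrier
    stateBehavior q []      = τ q
    stateBehavior q (a ∷ v) = δ q a ⟨ (λ q′ → stateBehavior q′ v) ⟩

    behavior : WeightedLanguage A
    behavior w = P₀ ⟨ (λ q → stateBehavior q w) ⟩

  Recognizes : ∀ {a} {A : Alphabet a} → WAFA A → WeightedLanguage A → Set (ℓ ⊔ a)
  Recognizes 𝒜 s = ∀ w → WAFA.behavior 𝒜 w ≈ s w

  Recognizable : ∀ {a} (A : Alphabet a) → WeightedLanguage A → Set (c ⊔ ℓ ⊔ a)
  Recognizable A s = Σ[ 𝒜 ∈ WAFA A ] Recognizes 𝒜 s

  inverseImage : ∀ {a b} (A : Alphabet a) (B : Alphabet b) → (Word A → Word B) →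
                 WeightedLanguage B → WeightedLanguage A
  inverseImage A B h s w = s (h w)

{-# OPTIONS --safe #-}
-- A word u over Σ acts on a WAFA by iterated substitution of its transition
-- polynomials: starting from the variable q, each letter of u substitutes δ into
-- what follows.  The result is a polynomial whose value at the state behaviors
-- on v is the behavior of q on u v.  Keeping the states, P₀ and τ, and reading a
-- letter a through the polynomial of the word h(a), one obtains a WAFA whose
-- state behavior on w is the original one on h(w).
module Submission where

open import Defs
open import Algebra.Bundles using (CommutativeSemiring)
open import Algebra.Definitions.RawSemiring as RawSemiringDefinitions using ()
open import Algebra.Morphism.Structures using (module MonoidMorphisms)
open import Algebra.Properties.CommutativeMonoid.Sum as CommutativeMonoidSum using ()
open import Algebra.Properties.CommutativeSemigroup as CommutativeSemigroupProperties using ()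
open import Algebra.Properties.Semiring.Exp as Exp using ()
open import Data.Fin.Base using (Fin; zero; suc)
open import Data.List.Base using ([]; _∷_; _++_; [_]; map; cartesianProductWith)
open import Data.Nat.Base as ℕ using (ℕ)
open import Data.Product.Base using (_×_; _,_)
open import Data.Vec.Base using (Vec; _∷_; lookup; replicate; zipWith)
open import Data.Vec.Functional as Vector using (Vector)
open import Data.Vec.Properties using (lookup-replicate; lookup-zipWith)
open import Function.Base using (_∘_)
open import Relation.Binary.PropositionalEquality.Core as ≡ using ()
import Relation.Binary.Reasoning.Setoid as ≈-Reasoning

module PolynomialSubstitution {c ℓ} (S : CommutativeSemiring c ℓ) where

  open CommutativeSemiring S hiding (zero)
  open RawSemiringDefinitions rawSemiring using (product; _^_)
  open CommutativeMonoidSum *-commutativeMonoid using ()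
    renaming (sum-cong-≋ to product-cong; ∑-distrib-+ to product-distrib-*;
              sum-replicate-zero to product-replicate-1)
  open CommutativeSemigroupProperties *-commutativeSemigroup using (interchange)
  open Exp semiring using (^-congˡ; ^-congʳ; ^-homo-*)
  open ≈-Reasoning setoid

  private
    variable
      m n : ℕ

  -- Polynomials have no normal form here, so each operation below is characterised only by its
  -- value at every point `x`; no equality of polynomials is ever used.
  ⟦_⟧ : Polynomial S n → Vector Carrier n → Carrier
  ⟦ p ⟧ x = _⟨_⟩ S p x

  monomial : Vec ℕ n → Vector Carrier n → Carrier
  monomial e x = product (λ i → x i ^ lookup e i)

  monomial-cong : ∀ (e : Vec ℕ n) {x y} → (∀ i → x i ≈ y i) → monomial e x ≈ monomial e y
  monomial-cong e x≈y = product-cong (λ i → ^-congˡ (lookup e i) (x≈y i))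

  monomial-0 : ∀ (x : Vector Carrier n) → monomial (replicate n 0) x ≈ 1#
  monomial-0 {n} x = trans
    (product-cong (λ i → ^-congʳ (x i) (lookup-replicate i 0)))
    (product-replicate-1 n)

  -- Powers add exponents factor by factor; regrouping the factors into two products uses
  -- commutativity of multiplication.
  monomial-+ : ∀ (e f : Vec ℕ n) x →
               monomial (zipWith ℕ._+_ e f) x ≈ monomial e x * monomial f x
  monomial-+ e f x = begin
    product (λ i → x i ^ lookup (zipWith ℕ._+_ e f) i)
      ≈⟨ product-cong (λ i → ^-congʳ (x i) (lookup-zipWith ℕ._+_ i e f)) ⟩
    product (λ i → x i ^ (lookup e i ℕ.+ lookup f i))
      ≈⟨ product-cong (λ i → ^-homo-* (x i) (lookup e i) (lookup f i)) ⟩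
    product (λ i → x i ^ lookup e i * x i ^ lookup f i)
      ≈⟨ product-distrib-* (λ i → x i ^ lookup e i) (λ i → x i ^ lookup f i) ⟩
    monomial e x * monomial f x ∎

  -- This carries induction hypotheses about state behaviors, which hold only up to `≈`, under a
  -- polynomial.
  ⟦⟧-cong : ∀ (p : Polynomial S n) {x y} → (∀ i → x i ≈ y i) → ⟦ p ⟧ x ≈ ⟦ p ⟧ y
  ⟦⟧-cong []            x≈y = refl
  ⟦⟧-cong ((s , e) ∷ p) x≈y = +-cong (*-congˡ (monomial-cong e x≈y)) (⟦⟧-cong p x≈y)

  ⟦⟧-++ : ∀ (p q : Polynomial S n) x → ⟦ p ++ q ⟧ x ≈ ⟦ p ⟧ x + ⟦ q ⟧ x
  ⟦⟧-++ []            q x = sym (+-identityˡ _)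
  ⟦⟧-++ ((s , e) ∷ p) q x = trans (+-congˡ (⟦⟧-++ p q x)) (sym (+-assoc _ _ _))

  constant : Carrier → Polynomial S n
  constant {n} s = [ s , replicate n 0 ]

  ⟦constant⟧ : ∀ s (x : Vector Carrier n) → ⟦ constant s ⟧ x ≈ s
  ⟦constant⟧ s x = begin
    s * monomial (replicate _ 0) x + 0#  ≈⟨ +-identityʳ _ ⟩
    s * monomial (replicate _ 0) x       ≈⟨ *-congˡ (monomial-0 x) ⟩
    s * 1#                               ≈⟨ *-identityʳ s ⟩
    s                                    ∎

  unit : Fin n → Vec ℕ n
  unit zero    = 1 ∷ replicate _ 0
  unit (suc i) = 0 ∷ unit i

  monomial-unit : ∀ (i : Fin n) x → monomial (unit i) x ≈ x i
  monomial-unit zero x = begin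
    -- The exponent 1 unfolds to `x zero * 1#`, and all remaining exponents are 0.
    x zero * 1# * monomial (replicate _ 0) (x ∘ suc)
      ≈⟨ *-cong (*-identityʳ _) (monomial-0 (x ∘ suc)) ⟩
    x zero * 1#
      ≈⟨ *-identityʳ _ ⟩
    x zero ∎
  monomial-unit (suc i) x = trans (*-identityˡ _) (monomial-unit i (x ∘ suc))

  var : Fin n → Polynomial S n
  var i = [ 1# , unit i ]

  ⟦var⟧ : ∀ (i : Fin n) x → ⟦ var i ⟧ x ≈ x i
  ⟦var⟧ i x = begin
    1# * monomial (unit i) x + 0#  ≈⟨ +-identityʳ _ ⟩
    1# * monomial (unit i) x       ≈⟨ *-identityˡ _ ⟩
    monomial (unit i) x            ≈⟨ monomial-unit i x ⟩
    x i                            ∎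

  infixl 7 _*ᵗ_ _*ᴾ_
  infixr 8 _^ᴾ_

  _*ᵗ_ : Carrier × Vec ℕ n → Carrier × Vec ℕ n → Carrier × Vec ℕ n
  (s , e) *ᵗ (t , f) = s * t , zipWith ℕ._+_ e f

  _*ᴾ_ : Polynomial S n → Polynomial S n → Polynomial S n
  _*ᴾ_ = cartesianProductWith _*ᵗ_

  ⟦map-*ᵗ⟧ : ∀ s e (p : Polynomial S n) x →
             ⟦ map ((s , e) *ᵗ_) p ⟧ x ≈ s * monomial e x * ⟦ p ⟧ x
  ⟦map-*ᵗ⟧ s e []            x = sym (zeroʳ _)
  ⟦map-*ᵗ⟧ s e ((t , f) ∷ p) x = begin
    s * t * monomial (zipWith ℕ._+_ e f) x + ⟦ map ((s , e) *ᵗ_) p ⟧ x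
      ≈⟨ +-cong (*-congˡ (monomial-+ e f x)) (⟦map-*ᵗ⟧ s e p x) ⟩
    s * t * (monomial e x * monomial f x) + s * monomial e x * ⟦ p ⟧ x
      -- Commutativity lets `t` pass `monomial e x`, so that the fixed term becomes a common left
      -- factor.
      ≈⟨ +-congʳ (interchange s t (monomial e x) (monomial f x)) ⟩
    s * monomial e x * (t * monomial f x) + s * monomial e x * ⟦ p ⟧ x
      ≈⟨ distribˡ _ _ _ ⟨
    s * monomial e x * (t * monomial f x + ⟦ p ⟧ x) ∎

  ⟦⟧-*ᴾ : ∀ (p q : Polynomial S n) x → ⟦ p *ᴾ q ⟧ x ≈ ⟦ p ⟧ x * ⟦ q ⟧ x
  ⟦⟧-*ᴾ []            q x = sym (zeroˡ _)
  ⟦⟧-*ᴾ ((s , e) ∷ p) q x = begin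
    -- By definition of `cartesianProductWith`, the product splits off the row of its first term.
    ⟦ map ((s , e) *ᵗ_) q ++ p *ᴾ q ⟧ x
      ≈⟨ ⟦⟧-++ (map ((s , e) *ᵗ_) q) (p *ᴾ q) x ⟩
    ⟦ map ((s , e) *ᵗ_) q ⟧ x + ⟦ p *ᴾ q ⟧ x
      ≈⟨ +-cong (⟦map-*ᵗ⟧ s e q x) (⟦⟧-*ᴾ p q x) ⟩
    s * monomial e x * ⟦ q ⟧ x + ⟦ p ⟧ x * ⟦ q ⟧ x
      ≈⟨ distribʳ _ _ _ ⟨
    (s * monomial e x + ⟦ p ⟧ x) * ⟦ q ⟧ x ∎

  _^ᴾ_ : Polynomial S n → ℕ → Polynomial S n
  p ^ᴾ ℕ.zero  = constant 1#
  p ^ᴾ ℕ.suc k = p *ᴾ p ^ᴾ k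

  ⟦⟧-^ᴾ : ∀ (p : Polynomial S n) k x → ⟦ p ^ᴾ k ⟧ x ≈ ⟦ p ⟧ x ^ k
  ⟦⟧-^ᴾ p ℕ.zero    x = ⟦constant⟧ 1# x
  ⟦⟧-^ᴾ p (ℕ.suc k) x = trans (⟦⟧-*ᴾ p (p ^ᴾ k) x) (*-congˡ (⟦⟧-^ᴾ p k x))

  -- There is one factor for each of the `m` indeterminates being replaced, while the factors
  -- themselves live in `n` indeterminates.
  productᴾ : Vector (Polynomial S n) m → Polynomial S n
  productᴾ = Vector.foldr _*ᴾ_ (constant 1#)

  ⟦productᴾ⟧ : ∀ (r : Vector (Polynomial S n) m) x →
               ⟦ productᴾ r ⟧ x ≈ product (λ i → ⟦ r i ⟧ x)
  ⟦productᴾ⟧ {m = ℕ.zero}  r x = ⟦constant⟧ 1# x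
  ⟦productᴾ⟧ {m = ℕ.suc m} r x = trans
    (⟦⟧-*ᴾ (r zero) (productᴾ (r ∘ suc)) x)
    (*-congˡ (⟦productᴾ⟧ (r ∘ suc) x))

  substitute : Polynomial S m → Vector (Polynomial S n) m → Polynomial S n
  substitute []            r = []
  substitute ((s , e) ∷ p) r =
    constant s *ᴾ productᴾ (λ i → r i ^ᴾ lookup e i) ++ substitute p r

  -- Evaluation at `x` respects sums, products, powers and constants, hence any expression built
  -- from them.
  ⟦substitute⟧ : ∀ (p : Polynomial S m) (r : Vector (Polynomial S n) m) x →
                 ⟦ substitute p r ⟧ x ≈ ⟦ p ⟧ (λ i → ⟦ r i ⟧ x)
  ⟦substitute⟧ []            r x = refl
  ⟦substitute⟧ ((s , e) ∷ p) r x = begin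
    ⟦ constant s *ᴾ productᴾ rᵉ ++ substitute p r ⟧ x
      ≈⟨ ⟦⟧-++ (constant s *ᴾ productᴾ rᵉ) (substitute p r) x ⟩
    ⟦ constant s *ᴾ productᴾ rᵉ ⟧ x + ⟦ substitute p r ⟧ x
      ≈⟨ +-cong (⟦⟧-*ᴾ (constant s) (productᴾ rᵉ) x) (⟦substitute⟧ p r x) ⟩
    ⟦ constant s ⟧ x * ⟦ productᴾ rᵉ ⟧ x + ⟦ p ⟧ (λ i → ⟦ r i ⟧ x)
      ≈⟨ +-congʳ (*-cong (⟦constant⟧ s x) (⟦productᴾ⟧ rᵉ x)) ⟩
    s * product (λ i → ⟦ rᵉ i ⟧ x) + ⟦ p ⟧ (λ i → ⟦ r i ⟧ x)
      ≈⟨ +-congʳ (*-congˡ (product-cong (λ i → ⟦⟧-^ᴾ (r i) (lookup e i) x))) ⟩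
    s * monomial e (λ i → ⟦ r i ⟧ x) + ⟦ p ⟧ (λ i → ⟦ r i ⟧ x) ∎
    where rᵉ = λ i → r i ^ᴾ lookup e i

module InverseHomomorphism {c ℓ a b} (S : CommutativeSemiring c ℓ)
  {Λ : Alphabet a} {Σ : Alphabet b} (𝒜 : WAFA S Σ) where

  open CommutativeSemiring S
  open PolynomialSubstitution S
  open WAFA 𝒜

  δ* : Fin n → Word Σ → Polynomial S n
  δ* q []      = var q
  δ* q (a ∷ u) = substitute (δ q a) (λ q′ → δ* q′ u)

  -- Induction on `u` for all states at once, since `δ q a` may mention every state.
  ⟦δ*⟧ : ∀ q u v → ⟦ δ* q u ⟧ (λ q′ → stateBehavior q′ v) ≈ stateBehavior q (u ++ v)
  ⟦δ*⟧ q []      v = ⟦var⟧ q _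
  ⟦δ*⟧ q (a ∷ u) v = trans
    (⟦substitute⟧ (δ q a) (λ q′ → δ* q′ u) _)
    (⟦⟧-cong (δ q a) (λ q′ → ⟦δ*⟧ q′ u v))

  module _ (h : Word Λ → Word Σ) (h-homo : IsWordHomomorphism Λ Σ h) where

    open MonoidMorphisms.IsMonoidHomomorphism h-homo using (homo; ε-homo)

    preimage : WAFA S Λ
    preimage = record
      { n  = n
      -- If `h` erases `a`, this is `var q`, so reading `a` leaves the behavior of `q` unchanged.
      ; δ  = λ q a → δ* q (h [ a ])
      ; P₀ = P₀
      ; τ  = τ
      }

    stateBehavior-preimage : ∀ q w → WAFA.stateBehavior preimage q w ≈ stateBehavior q (h w)
    -- The final weights can be kept because `h` sends the empty word to the empty word.
    stateBehavior-preimage q []      = reflexive (≡.cong (stateBehavior q) (≡.sym ε-homo))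
    stateBehavior-preimage q (a ∷ w) = begin
      ⟦ δ* q (h [ a ]) ⟧ (λ q′ → WAFA.stateBehavior preimage q′ w)
        ≈⟨ ⟦⟧-cong (δ* q (h [ a ])) (λ q′ → stateBehavior-preimage q′ w) ⟩
      ⟦ δ* q (h [ a ]) ⟧ (λ q′ → stateBehavior q′ (h w))
        ≈⟨ ⟦δ*⟧ q (h [ a ]) (h w) ⟩
      stateBehavior q (h [ a ] ++ h w)
        -- `a ∷ w` is `[ a ] ++ w` by computation, so `homo` applies directly.
        ≡⟨ ≡.cong (stateBehavior q) (homo [ a ] w) ⟨
      stateBehavior q (h (a ∷ w)) ∎
      where open ≈-Reasoning setoid

    behavior-preimage : ∀ w → WAFA.behavior preimage w ≈ behavior (h w)
    behavior-preimage w = ⟦⟧-cong P₀ (λ q → stateBehavior-preimage q w)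

corollary5p2 : ∀ {c ℓ a b} (S : CommutativeSemiring c ℓ)
    (Λ : Alphabet a) (Σ : Alphabet b)
    (h : Word Λ → Word Σ) → IsWordHomomorphism Λ Σ h →
    (s : WeightedLanguage S Σ) → Recognizable S Σ s →
    Recognizable S Λ (inverseImage S Λ Σ h s)
corollary5p2 S Λ Σ h h-homo s (𝒜 , 𝒜-recognizes-s) =
  preimage h h-homo , λ w → trans (behavior-preimage h h-homo w) (𝒜-recognizes-s (h w))
  where
  open CommutativeSemiring S using (trans)
  open InverseHomomorphism S {Λ} {Σ} 𝒜
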